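{- For every prime $p$ and every natural number $c \geq 1$, $$\binom{2p^c-1}{p^c}\equiv 1 \pmod p.$$
   Context: Natural numbers are positive integers here; $\binom{n}{x}$ denotes the usual binomial coefficient. -}

module Defs where

open import Data.Integer.Base using (ℤ; _-_)
open import Data.Integer.Divisibility using (_∣_)

infix 4 _≡_[mod_]

_≡_[mod_] : ℤ → ℤ → ℤ → Set
a ≡ b [mod n ] = n ∣ (a - b)

{-# OPTIONS --safe #-}
-- Put q = p ^ c.  The absorption identity k * (q C k) = q * ((q - 1) C (k - 1))
-- forces p to divide q C k for 0 < k < q.  Hence Pascal's rule, run from row q
-- instead of row 0, gives (q + m) C k ≡ m C k (mod p) for k < q.  By symmetry
-- the coefficient sought is (2q - 1) C (q - 1), so it is ≡ (q - 1) C (q - 1) = 1.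
module Submission where

open import Defs
open import Data.Nat.Base using (ℕ; _*_; _∸_; _^_; _≥_)
open import Data.Nat.Combinatorics using (_C_)
open import Data.Nat.Primality using (Prime)
open import Data.Integer.Base using (+_)

open import Data.Nat.Base using (zero; suc; _+_; _<_; NonZero)
open import Data.Nat.Combinatorics
  using (nCk≡nC[n∸k]; nCn≡1; nC1≡n; nCk+nC[k+1]≡[n+1]C[k+1])
open import Data.Nat.Divisibility
  using (_∣_; divides-refl; _∣0; 1∣_; ∣-trans; m∣m*n; >⇒∤; *-monoˡ-∣; *-cancelˡ-∣;
         ∣m∣n⇒∣m+n)
open import Data.Nat.Primality using (euclidsLemma; prime⇒nonZero)
open import Data.Nat.Properties
  using (*-identityˡ; *-identityʳ; *-zeroʳ; *-distribˡ-+; *-comm; *-assoc;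
         +-identityʳ; <-trans; n<1+n; m≤n+m; m+n∸n≡m; m^n≢0)
open import Data.Nat.Tactic.RingSolver using (solve-∀)
open import Data.Product.Base using (∃-syntax; _×_; _,_)
open import Data.Sum.Base using (_⊎_; inj₁; inj₂; map₁)
open import Function.Base using (_$_; _∘_)
open import Relation.Binary.PropositionalEquality
  using (_≡_; refl; sym; trans; cong; cong₂; subst; module ≡-Reasoning)
open import Relation.Nullary.Negation using (contradiction)

open ≡-Reasoning

-- Induction along Pascal's rule: one copy of `a` is set aside, the induction hypothesis in columns
-- `k` and `suc k` rewrites the rest, and Pascal's rule merges that into a further `suc n` copies of
-- `a`.
[k+1]*[n+1]C[k+1]≡[n+1]*nCk : ∀ n k → suc k * (suc n C suc k) ≡ suc n * (n C k)
[k+1]*[n+1]C[k+1]≡[n+1]*nCk n zero = begin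
  1 * (suc n C 1) ≡⟨ *-identityˡ (suc n C 1) ⟩
  suc n C 1       ≡⟨ nC1≡n (suc n) ⟩
  suc n           ≡⟨ *-identityʳ (suc n) ⟨
  suc n * (n C 0) ∎
[k+1]*[n+1]C[k+1]≡[n+1]*nCk zero (suc k) = *-zeroʳ k
[k+1]*[n+1]C[k+1]≡[n+1]*nCk (suc n) (suc k) = begin
  suc (suc k) * (suc (suc n) C suc (suc k))
    ≡⟨ cong (suc (suc k) *_) (nCk+nC[k+1]≡[n+1]C[k+1] (suc n) (suc k)) ⟨
  suc (suc k) * (a + b)
    ≡⟨ expand k a b ⟩
  a + (suc k * a + suc (suc k) * b)
    ≡⟨ cong (λ x → a + x) (cong₂ _+_ ([k+1]*[n+1]C[k+1]≡[n+1]*nCk n k)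
                                      ([k+1]*[n+1]C[k+1]≡[n+1]*nCk n (suc k))) ⟩
  a + (suc n * (n C k) + suc n * (n C suc k))
    ≡⟨ cong (λ x → a + x) (*-distribˡ-+ (suc n) (n C k) (n C suc k)) ⟨
  a + suc n * (n C k + n C suc k)
    ≡⟨ cong (λ x → a + suc n * x) (nCk+nC[k+1]≡[n+1]C[k+1] n k) ⟩
  suc (suc n) * a ∎
  where
  a = suc n C suc k
  b = suc n C suc (suc k)

  expand : ∀ k a b → suc (suc k) * (a + b) ≡ a + (suc k * a + suc (suc k) * b)
  expand = solve-∀

-- Factors of `p` are peeled off one at a time: unless `p` divides `n`, Euclid's lemma puts each of
-- them into `m`.
p^c∣m*n⇒p^c∣m⊎p∣n : ∀ {p} → Prime p → ∀ c m n → p ^ c ∣ m * n → p ^ c ∣ m ⊎ p ∣ n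
p^c∣m*n⇒p^c∣m⊎p∣n     pr zero    m n _ = inj₁ (1∣ m)
p^c∣m*n⇒p^c∣m⊎p∣n {p} pr (suc c) m n pᶜ⁺¹∣mn
  with euclidsLemma m n pr (∣-trans (m∣m*n (p ^ c)) pᶜ⁺¹∣mn)
... | inj₂ p∣n = inj₂ p∣n
-- Here `m` is `l * p`; cancelling one `p` leaves the same claim for `c` and `l`.
... | inj₁ (divides-refl l) = map₁ p^c∣l⇒p^[c+1]∣l*p (p^c∣m*n⇒p^c∣m⊎p∣n pr c l n pᶜ∣ln)
  where
  instance _ = prime⇒nonZero pr

  pᶜ∣ln : p ^ c ∣ l * n
  pᶜ∣ln = *-cancelˡ-∣ p $ subst (p * p ^ c ∣_) (trans (cong (_* n) (*-comm l p)) (*-assoc p l n)) pᶜ⁺¹∣mn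

  p^c∣l⇒p^[c+1]∣l*p : p ^ c ∣ l → p ^ suc c ∣ l * p
  p^c∣l⇒p^[c+1]∣l*p = subst (_∣ l * p) (*-comm (p ^ c) p) ∘ *-monoˡ-∣ p

-- By absorption `p ^ c` divides `suc k * ((p ^ c) C suc k)`, but it is too large to divide `suc k`.
p∣[p^c]C[k+1] : ∀ {p} → Prime p → ∀ c k → suc k < p ^ c → p ∣ (p ^ c) C suc k
p∣[p^c]C[k+1] {p} pr c k k+1<pᶜ
  with p^c∣m*n⇒p^c∣m⊎p∣n pr c (suc k) ((p ^ c) C suc k) (q∣[k+1]*qC[k+1] (p ^ c))
  where
  -- Absorption needs a successor as row index, which `p ^ c` is not syntactically; hence the case
  -- split on a general `q`.
  q∣[k+1]*qC[k+1] : ∀ q → q ∣ suc k * (q C suc k)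
  q∣[k+1]*qC[k+1] zero    = subst (0 ∣_) (sym (*-zeroʳ k)) (0 ∣0)
  q∣[k+1]*qC[k+1] (suc r) =
    subst (suc r ∣_) (sym ([k+1]*[n+1]C[k+1]≡[n+1]*nCk r k)) (m∣m*n (r C k))
... | inj₁ pᶜ∣k+1 = contradiction pᶜ∣k+1 (>⇒∤ k+1<pᶜ)
... | inj₂ p∣C    = p∣C

module _ {d q} (d∣qC[k+1] : ∀ k → suc k < q → d ∣ q C suc k) where

  -- The congruence is kept in the naturals by an explicit error term `e`; Pascal's rule adds the
  -- errors of two neighbouring columns.
  [m+q]Ck≡mCk+d : ∀ m k → k < q → ∃[ e ] d ∣ e × (m + q) C k ≡ m C k + e
  [m+q]Ck≡mCk+d m       zero    _     = 0 , (d ∣0) , refl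
  [m+q]Ck≡mCk+d zero    (suc k) k+1<q = q C suc k , d∣qC[k+1] k k+1<q , refl
  [m+q]Ck≡mCk+d (suc m) (suc k) k+1<q
    with e , d∣e , eq ← [m+q]Ck≡mCk+d m k (<-trans (n<1+n k) k+1<q)
       | f , d∣f , fq ← [m+q]Ck≡mCk+d m (suc k) k+1<q
    = e + f , ∣m∣n⇒∣m+n d∣e d∣f , (begin
      (suc m + q) C suc k               ≡⟨ nCk+nC[k+1]≡[n+1]C[k+1] (m + q) k ⟨
      (m + q) C k + (m + q) C suc k     ≡⟨ cong₂ _+_ eq fq ⟩
      (m C k + e) + (m C suc k + f)     ≡⟨ interchange (m C k) e (m C suc k) f ⟩
      (m C k + m C suc k) + (e + f)     ≡⟨ cong (_+ (e + f)) (nCk+nC[k+1]≡[n+1]C[k+1] m k) ⟩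
      suc m C suc k + (e + f)           ∎)
    where
    interchange : ∀ a b c d → (a + b) + (c + d) ≡ (a + c) + (b + d)
    interchange = solve-∀

[2q∸1]Cq≡1 : ∀ {d} q .{{_ : NonZero q}} → (∀ k → suc k < q → d ∣ q C suc k) →
             + ((2 * q ∸ 1) C q) ≡ + 1 [mod + d ]
[2q∸1]Cq≡1 {d} (suc r) d∣qC[k+1]
  -- Column `q` itself is out of range, since `q C q` is 1; its mirror image in row `r + q` is
  -- column `r`, the last one allowed.
  with e , d∣e , eq ← [m+q]Ck≡mCk+d d∣qC[k+1] r r (n<1+n r)
  -- The difference `+ (1 + e) - + 1` computes to `+ e`, so `d∣e` is already the required integer
  -- divisibility.
  = subst (λ x → + x ≡ + 1 [mod + d ]) (sym C≡1+e) d∣e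
  where
  q = suc r

  C≡1+e : (2 * q ∸ 1) C q ≡ 1 + e
  C≡1+e = begin
    (r + (q + 0)) C q     ≡⟨ cong (λ x → (r + x) C q) (+-identityʳ q) ⟩
    (r + q) C q           ≡⟨ nCk≡nC[n∸k] (m≤n+m q r) ⟩
    (r + q) C (r + q ∸ q) ≡⟨ cong ((r + q) C_) (m+n∸n≡m r q) ⟩
    (r + q) C r           ≡⟨ eq ⟩
    r C r + e             ≡⟨ cong (_+ e) (nCn≡1 r) ⟩
    1 + e                 ∎

theorem2p10 : ∀ (p : ℕ) → Prime p → ∀ (c : ℕ) → c ≥ 1 →
    + ((2 * p ^ c ∸ 1) C (p ^ c)) ≡ + 1 [mod + p ]
theorem2p10 p pr c _ = [2q∸1]Cq≡1 (p ^ c) (p∣[p^c]C[k+1] pr c)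
  where instance
  _ = prime⇒nonZero pr
  _ = m^n≢0 p c
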